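{- Let $W\subseteq\{0,1\}^m$ be a nonempty finite set of binary strings of length $m$, and let $\overline W$ be the set of bitwise negations of the strings in $W$. When negation is allowed, the number of strings in $\{0,1\}^m$ representable by $W$ is $2^{|U|}$, where $U$ is the set of equivalence classes of $\{1,\dots,m\}$ derived from $W\cup\overline W$.
   Context: For $x\in\{0,1\}^m$, $b^x_i$ denotes its $i$-th bit. For $i\in\{1,\dots,m\}$ let $T_i=\{x\in W\cup\overline W \mid b^x_i=0\}$. The equivalence relation $\sim$ on $\{1,\dots,m\}$ derived from $W\cup\overline W$ is given by $i\sim j$ if and only if $T_i=T_j$, and $U$ is the set of its equivalence classes. A string $s\in\{0,1\}^m$ is representable by $W$ when negation is allowed if there is a formula built with the operators bitwise AND $\wedge$, bitwise OR $\vee$ and bitwise negation, whose operands are (at least one, possibly repeated) elements of $W$, which evaluates to $s$. -}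

module Defs where

open import Data.Bool.Base using (Bool; false; not; _∧_; _∨_)
open import Data.Fin.Base using (Fin)
import Data.Fin.Subset as Subset
open import Data.List.Base using (List; length)
import Data.List.Membership.Propositional as List
open import Data.List.Relation.Unary.Unique.Propositional using (Unique)
open import Data.Nat.Base using (ℕ)
open import Data.Product.Base using (_×_; ∃; ∃-syntax)
open import Data.Vec.Base using (Vec; lookup; map; zipWith)
open import Function.Bundles using (_⇔_)
open import Level using (Level; _⊔_)
open import Relation.Binary.Core using (Rel)
open import Relation.Binary.PropositionalEquality.Core using (_≡_)
open import Relation.Unary using (Pred; _∈_; _∩_; _≐_)

private
  variable
    a ℓ : Level
    A : Set a
    m : ℕ

-- P is a finite set with exactly n elements: some duplicate-free list of
-- length n has precisely the elements of P as its members.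
_HasSize_ : {A : Set a} → Pred A ℓ → ℕ → Set (a ⊔ ℓ)
_HasSize_ {A = A} P n =
  ∃[ xs ] Unique xs × length xs ≡ n × (∀ (x : A) → (x List.∈ xs) ⇔ (x ∈ P))

Finite : {A : Set a} → Pred A ℓ → Set (a ⊔ ℓ)
Finite P = ∃[ n ] P HasSize n

-- The bit 0 is false and the bit 1 is true.
BitString : ℕ → Set
BitString = Vec Bool

-- The set of bitwise negations of the elements of W.
Negations : Pred (BitString m) ℓ → Pred (BitString m) ℓ
Negations W y = ∃[ x ] x ∈ W × y ≡ map not x

T : Pred (BitString m) ℓ → Fin m → Pred (BitString m) ℓ
T X i = X ∩ (λ x → lookup x i ≡ false)

-- i ∼ j is written  Derived X i j,  for the relation ∼ derived from X;
-- equality of T X i and T X j as sets is extensional.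
Derived : Pred (BitString m) ℓ → Rel (Fin m) ℓ
Derived X i j = T X i ≐ T X j

-- The set of equivalence classes of a relation on positions.  The classes are
-- elements of Subset m, whose propositional equality is extensional, so that
-- related positions give one and the same class.
Classes : Rel (Fin m) ℓ → Pred (Subset.Subset m) ℓ
Classes _∼_ C = ∃[ i ] ∀ j → (j Subset.∈ C) ⇔ (i ∼ j)

infixr 7 _⋀_
infixr 6 _⋁_

data Formula {m : ℕ} (W : Pred (BitString m) ℓ) : Set ℓ where
  operand : ∀ x → x ∈ W → Formula W
  _⋀_     : Formula W → Formula W → Formula W
  _⋁_     : Formula W → Formula W → Formula W
  neg     : Formula W → Formula W

eval : {W : Pred (BitString m) ℓ} → Formula W → BitString m
eval (operand x _) = x
eval (φ ⋀ ψ)       = zipWith _∧_ (eval φ) (eval ψ)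
eval (φ ⋁ ψ)       = zipWith _∨_ (eval φ) (eval ψ)
eval (neg φ)       = map not (eval φ)

Representable : Pred (BitString m) ℓ → Pred (BitString m) ℓ
Representable W s = ∃ λ (φ : Formula W) → eval φ ≡ s

{-# OPTIONS --safe #-}

-- Call two positions equivalent when no string of W tells them apart; this is
-- the relation ∼ derived from W and its negations.  A string is representable
-- iff it is constant on the equivalence classes: formulas act bitwise, and
-- conversely the indicator of the class of i is the conjunction of the operands,
-- each negated unless its bit at i is 1, so that a string constant on classes is
-- a disjunction of indicators.  Such strings correspond to arbitrary bit
-- assignments to the classes.
module Submission where

open import Defs
open import Data.Bool.Base using (Bool; true; false; not; _∧_; _∨_)
open import Data.Bool.Properties using (not-injective; ¬-not) renaming (_≟_ to _≟ᵇ_)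
open import Data.Fin.Base using (Fin; zero; suc; combine; finToFun; funToFin)
open import Data.Fin.Properties using (2↔Bool; finToFun-funToFin; funToFin-finToFin)
open import Data.Fin.Subset as Subset using (Subset)
open import Data.Fin.Subset.Properties as Subsetₚ
  using (⊆-antisym; x∈p∩q⁺; x∈p∩q⁻; x∈p∪q⁺; x∈p∪q⁻; x∈∁p⇒x∉p; x∉p⇒x∈∁p)
open import Data.List.Base as List using (List; []; _∷_; allFin; deduplicate; filter; length)
open import Data.List.Membership.Propositional using (find; mapWith∈) renaming (_∈_ to _∈ˡ_)
open import Data.List.Membership.Propositional.Properties
  using (∈-allFin; ∈-deduplicate⁺; ∈-deduplicate⁻; ∈-filter⁺; ∈-filter⁻; ∈-lookup;
         ∈-map⁺; ∈-map⁻; ∈-tabulate⁺; ∈-tabulate⁻)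
open import Data.List.Properties using (length-tabulate)
open import Data.List.Relation.Unary.All as All using (All; []; _∷_)
import Data.List.Relation.Unary.All.Properties as Allₚ
open import Data.List.Relation.Unary.AllPairs using (_∷_)
open import Data.List.Relation.Unary.Any as Any using (Any; here; there; index)
open import Data.List.Relation.Unary.Any.Properties as Anyₚ using (lookup-index; mapWith∈⁺)
open import Data.List.Relation.Unary.Unique.Propositional using (Unique)
open import Data.List.Relation.Unary.Unique.Propositional.Properties using (tabulate⁺)
open import Data.Nat.Base using (ℕ; _^_)
open import Data.Product.Base using (_×_; _,_; proj₁; proj₂; ∃-syntax)
open import Data.Sum.Base using (inj₁; inj₂; [_,_]′)
open import Data.Vec.Base using (lookup; tabulate)
open import Data.Vec.Properties
  using (≡-dec; []=⇒lookup; lookup⇒[]=; lookup-map; lookup-zipWith; lookup∘tabulate;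
         tabulate∘lookup; tabulate-cong)
open import Function.Base using (_∘_; id)
open import Function.Bundles using (_⇔_; mk⇔; Equivalence; module Inverse)
open import Function.Definitions using (Injective; StrictlySurjective)
open import Level using (Level)
open import Relation.Binary.Core using (Rel)
open import Relation.Binary.Definitions using (Decidable)
open import Relation.Binary.PropositionalEquality
  using (_≡_; _≗_; refl; sym; trans; cong; cong₂; subst; module ≡-Reasoning)
open import Relation.Binary.Structures using (IsEquivalence)
open import Relation.Nullary.Decidable using (yes; no; does; map′; dec-true)
open import Relation.Nullary.Negation using (contradiction)
open import Relation.Unary using (Pred; Satisfiable; _∈_; _⊆_; _∪_; _≐_)

private
  variable
    a ℓ ℓ′ : Level
    A : Set a
    m n u : ℕ

-- Sizes of finite sets and the coding of functions by numbers.

HasSize-resp-≐ : {P : Pred A ℓ} {Q : Pred A ℓ′} → P ≐ Q → P HasSize n → Q HasSize n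
HasSize-resp-≐ (P⊆Q , Q⊆P) (xs , xs! , ∣xs∣ , ∈xs) =
  xs , xs! , ∣xs∣ , λ x →
    mk⇔ (P⊆Q ∘ Equivalence.to (∈xs x)) (Equivalence.from (∈xs x) ∘ Q⊆P)

image-HasSize : (f : Fin n → A) → Injective _≡_ _≡_ f → (λ x → ∃[ k ] x ≡ f k) HasSize n
image-HasSize f f-inj =
  List.tabulate f , tabulate⁺ f-inj , length-tabulate f , λ x →
    mk⇔ ∈-tabulate⁻ λ { (k , refl) → ∈-tabulate⁺ k }

lookup-injective : {xs : List A} → Unique xs → Injective _≡_ _≡_ (List.lookup xs)
lookup-injective (_ ∷ _)    {zero}  {zero}  _  = refl
lookup-injective (x∉ ∷ _)   {zero}  {suc j} eq = contradiction eq (All.lookup x∉ (∈-lookup j))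
lookup-injective (x∉ ∷ _)   {suc i} {zero}  eq = contradiction (sym eq) (All.lookup x∉ (∈-lookup i))
lookup-injective (_ ∷ xs!)  {suc i} {suc j} eq = cong suc (lookup-injective xs! eq)

-- Pointwise equal functions need not be propositionally equal, so `cong` does not apply; recursion
-- on the domain compares the codes digit by digit.
funToFin-cong : {f g : Fin m → Fin n} → f ≗ g → funToFin f ≡ funToFin g
funToFin-cong {m = ℕ.zero}  f≗g = refl
funToFin-cong {m = ℕ.suc _} f≗g = cong₂ combine (f≗g zero) (funToFin-cong (f≗g ∘ suc))

finToFun-injective : {k l : Fin (m ^ n)} → finToFun {m} {n} k ≗ finToFun l → k ≡ l
finToFun-injective {m} {n} {k} {l} eq = begin
  k                                ≡⟨ funToFin-finToFin {n} {m} k ⟨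
  funToFin (finToFun {m} {n} k)    ≡⟨ funToFin-cong eq ⟩
  funToFin (finToFun {m} {n} l)    ≡⟨ funToFin-finToFin {n} {m} l ⟩
  l                                ∎
  where open ≡-Reasoning

-- Equivalence classes of positions and invariant strings.

Invariant : Rel (Fin m) ℓ → Pred (BitString m) ℓ
Invariant _∼_ s = ∀ {i j} → i ∼ j → lookup s i ≡ lookup s j

-- Presents the set of classes as `Fin u`, with `q` sending a position to the number of its class,
-- so that counting invariant strings does not depend on how classes are represented.
IsQuotient : Rel (Fin m) ℓ → (Fin m → Fin u) → Set ℓ
IsQuotient _∼_ q = StrictlySurjective _≡_ q × (∀ i j → (i ∼ j) ⇔ (q i ≡ q j))

module _ {_∼_ : Rel (Fin m) ℓ} (∼-equiv : IsEquivalence _∼_) (_∼?_ : Decidable _∼_) where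

  private module ∼ = IsEquivalence ∼-equiv

  class : Fin m → Subset m
  class i = tabulate (λ j → does (i ∼? j))

  ∈-class⁺ : ∀ {i j} → i ∼ j → j Subset.∈ class i
  ∈-class⁺ {i} {j} i∼j =
    lookup⇒[]= j _ (trans (lookup∘tabulate _ j) (dec-true (i ∼? j) i∼j))

  ∈-class⁻ : ∀ {i j} → j Subset.∈ class i → i ∼ j
  -- Abstracting the equation together with the decision turns it into `false ≡ true` in the `no`
  -- case, which is therefore absent.
  ∈-class⁻ {i} {j} j∈ with i ∼? j | trans (sym (lookup∘tabulate (λ k → does (i ∼? k)) j)) ([]=⇒lookup j∈)
  ... | yes i∼j | _ = i∼j

  class-cong : ∀ {i j} → i ∼ j → class i ≡ class j
  class-cong i∼j = ⊆-antisym (λ k∈ → ∈-class⁺ (∼.trans (∼.sym i∼j) (∈-class⁻ k∈)))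
                             (λ k∈ → ∈-class⁺ (∼.trans i∼j (∈-class⁻ k∈)))

  class-injective : ∀ {i j} → class i ≡ class j → i ∼ j
  class-injective {j = j} eq = ∈-class⁻ (subst (j Subset.∈_) (sym eq) (∈-class⁺ ∼.refl))

  -- Each class is first listed once per member; by `class-cong` these entries are equal, so
  -- deduplication leaves one entry per class.
  classes : List (Subset m)
  classes = deduplicate (≡-dec _≟ᵇ_) (List.map class (allFin m))

  classes-! : Unique classes
  classes-! = deduplicate-! _
    where open import Data.List.Relation.Unary.Unique.DecPropositional.Properties (≡-dec _≟ᵇ_)
            using (deduplicate-!)

  class∈classes : ∀ i → class i ∈ˡ classes
  class∈classes i = ∈-deduplicate⁺ (≡-dec _≟ᵇ_) (∈-map⁺ class (∈-allFin i))

  classes⁻ : ∀ {C} → C ∈ˡ classes → ∃[ i ] C ≡ class i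
  classes⁻ C∈ with i , _ , eq ← ∈-map⁻ class (∈-deduplicate⁻ (≡-dec _≟ᵇ_) _ C∈) = i , eq

  Classes-HasSize : Classes _∼_ HasSize length classes
  Classes-HasSize = classes , classes-! , refl , λ C → mk⇔ to from
    where
    to : ∀ {C} → C ∈ˡ classes → C ∈ Classes _∼_
    to C∈ with i , refl ← classes⁻ C∈ = i , λ j → mk⇔ ∈-class⁻ ∈-class⁺

    from : ∀ {C} → C ∈ Classes _∼_ → C ∈ˡ classes
    from (i , C⇔) = subst (_∈ˡ classes)
      (⊆-antisym (λ {j} j∈ → Equivalence.from (C⇔ j) (∈-class⁻ j∈))
                 (λ {j} j∈ → ∈-class⁺ (Equivalence.to (C⇔ j) j∈)))
      (class∈classes i)

  quotient : Fin m → Fin (length classes)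
  quotient i = index (class∈classes i)

  lookup-quotient : ∀ i → class i ≡ List.lookup classes (quotient i)
  lookup-quotient i = lookup-index (class∈classes i)

  quotient-isQuotient : IsQuotient _∼_ quotient
  quotient-isQuotient = surj , λ i j → mk⇔
    (λ i∼j → lookup-injective classes-!
      (trans (sym (lookup-quotient i)) (trans (class-cong i∼j) (lookup-quotient j))))
    (λ eq → class-injective
      (trans (lookup-quotient i) (trans (cong (List.lookup classes) eq) (sym (lookup-quotient j)))))
    where
    surj : StrictlySurjective _≡_ quotient
    surj k with i , eq ← classes⁻ (∈-lookup {xs = classes} k) =
      i , lookup-injective classes-! (trans (sym (lookup-quotient i)) (sym eq))

-- Pulling back along `q` is a bijection from bit assignments on `Fin u` to invariant strings. An
-- assignment is coded by the number below `2 ^ u` having it as binary digits.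
Invariant-HasSize : {_∼_ : Rel (Fin m) ℓ} {q : Fin m → Fin u} →
                    IsQuotient _∼_ q → Invariant _∼_ HasSize (2 ^ u)
Invariant-HasSize {m = m} {u = u} {_∼_ = _∼_} {q} (surj , ∼⇔) =
  HasSize-resp-≐ (image⊆ , ⊆image) (image-HasSize pullback pullback-injective)
  where
  open Inverse 2↔Bool using (to; from; strictlyInverseˡ; strictlyInverseʳ)

  bits : Fin (2 ^ u) → Fin u → Bool
  bits k c = to (finToFun k c)

  pullback : Fin (2 ^ u) → BitString m
  pullback k = tabulate (bits k ∘ q)

  lookup-pullback : ∀ k i → lookup (pullback k) i ≡ bits k (q i)
  lookup-pullback k = lookup∘tabulate (bits k ∘ q)

  pullback-injective : Injective _≡_ _≡_ pullback
  -- Surjectivity of `q` makes every digit of the code appear as a bit of the string.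
  pullback-injective {k} {l} eq = finToFun-injective λ c →
    let i , qi≡c = surj c
        eqᵢ = trans (sym (lookup-pullback k i))
                (trans (cong (λ s → lookup s i) eq) (lookup-pullback l i))
        bits-eq = subst (λ c → bits k c ≡ bits l c) qi≡c eqᵢ
    in trans (sym (strictlyInverseʳ _)) (trans (cong from bits-eq) (strictlyInverseʳ _))

  image⊆ : (λ s → ∃[ k ] s ≡ pullback k) ⊆ Invariant _∼_
  image⊆ (k , refl) {i} {j} i∼j =
    trans (lookup-pullback k i)
      (trans (cong (bits k) (Equivalence.to (∼⇔ i j) i∼j)) (sym (lookup-pullback k j)))

  ⊆image : Invariant _∼_ ⊆ (λ s → ∃[ k ] s ≡ pullback k)
  ⊆image {s} inv = funToFin values , trans (sym (tabulate∘lookup s)) (tabulate-cong agree)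
    where
    -- The representative is whichever preimage surjectivity provides; invariance of `s` makes the
    -- choice immaterial.
    rep : Fin u → Fin m
    rep c = proj₁ (surj c)

    values : Fin u → Fin 2
    values c = from (lookup s (rep c))

    agree : ∀ i → lookup s i ≡ bits (funToFin values) (q i)
    agree i = begin
      lookup s i                         ≡⟨ inv (Equivalence.from (∼⇔ _ _) (proj₂ (surj (q i)))) ⟨
      lookup s (rep (q i))               ≡⟨ strictlyInverseˡ _ ⟨
      to (values (q i))                  ≡⟨ cong to (finToFun-funToFin values (q i)) ⟨
      bits (funToFin values) (q i)       ∎
      where open ≡-Reasoning

-- The relation derived from `W` and its negations.

module _ (W : Pred (BitString m) ℓ) where

  -- An elementwise form of the derived relation that speaks of `W` alone: it suits induction on
  -- formulas, and for finite `W` it is decided by checking a list.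
  Indistinguishable : Rel (Fin m) ℓ
  Indistinguishable i j = ∀ {w} → w ∈ W → lookup w i ≡ lookup w j

  -- The sets `T` record only bits equal to 0. A bit 1 of `w` at `i` is detected through the
  -- negation of `w`, which has bit 0 there.
  Derived⇒Indistinguishable : ∀ {i j} → Derived (W ∪ Negations W) i j → Indistinguishable i j
  Derived⇒Indistinguishable {i} {j} (Tᵢ⊆Tⱼ , _) {w} w∈W with lookup w i in wᵢ
  ... | false = sym (proj₂ (Tᵢ⊆Tⱼ (inj₁ w∈W , wᵢ)))
  ... | true  = not-injective (sym (trans (sym (lookup-map j not w)) (proj₂ (Tᵢ⊆Tⱼ
                  (inj₂ (w , w∈W , refl) , trans (lookup-map i not w) (cong not wᵢ))))))

  Indistinguishable-closed : ∀ {i j} → Indistinguishable i j →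
                             ∀ {x} → x ∈ W ∪ Negations W → lookup x i ≡ lookup x j
  Indistinguishable-closed i≈j (inj₁ x∈W) = i≈j x∈W
  Indistinguishable-closed {i} {j} i≈j (inj₂ (w , w∈W , refl)) =
    trans (lookup-map i not w) (trans (cong not (i≈j w∈W)) (sym (lookup-map j not w)))

  Indistinguishable⇒Derived : ∀ {i j} → Indistinguishable i j → Derived (W ∪ Negations W) i j
  Indistinguishable⇒Derived i≈j =
    (λ { (x∈ , xᵢ) → x∈ , trans (sym (Indistinguishable-closed i≈j x∈)) xᵢ }) ,
    (λ { (x∈ , xⱼ) → x∈ , trans (Indistinguishable-closed i≈j x∈) xⱼ })

  Derived-isEquivalence : IsEquivalence (Derived (W ∪ Negations W))
  Derived-isEquivalence = record
    { refl  = id , id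
    ; sym   = λ { (p , q) → q , p }
    ; trans = λ { (p , q) (p′ , q′) → p′ ∘ p , q ∘ q′ }
    }

  Derived-decidable : Finite W → Decidable (Derived (W ∪ Negations W))
  Derived-decidable (_ , ws , _ , _ , ∈ws) i j = map′
    (λ eqs → Indistinguishable⇒Derived (λ w∈W → All.lookup eqs (Equivalence.from (∈ws _) w∈W)))
    (λ i∼j → All.tabulate (λ w∈ws → Derived⇒Indistinguishable i∼j (Equivalence.to (∈ws _) w∈ws)))
    (All.all? (λ w → lookup w i ≟ᵇ lookup w j) ws)

  -- Formulas evaluated position by position.

  eval-invariant : (φ : Formula W) → Invariant Indistinguishable (eval φ)
  eval-invariant (operand x x∈W) i≈j = i≈j x∈W
  eval-invariant (φ ⋀ ψ) {i} {j} i≈j =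
    trans (lookup-zipWith _∧_ i (eval φ) (eval ψ))
      (trans (cong₂ _∧_ (eval-invariant φ i≈j) (eval-invariant ψ i≈j))
        (sym (lookup-zipWith _∧_ j (eval φ) (eval ψ))))
  eval-invariant (φ ⋁ ψ) {i} {j} i≈j =
    trans (lookup-zipWith _∨_ i (eval φ) (eval ψ))
      (trans (cong₂ _∨_ (eval-invariant φ i≈j) (eval-invariant ψ i≈j))
        (sym (lookup-zipWith _∨_ j (eval φ) (eval ψ))))
  eval-invariant (neg φ) {i} {j} i≈j =
    trans (lookup-map i not (eval φ))
      (trans (cong not (eval-invariant φ i≈j)) (sym (lookup-map j not (eval φ))))

  -- A string is read as the subset of its positions carrying the bit 1, so that
  -- ⋀, ⋁ and neg evaluate to intersection, union and complement.
  _⊨_ : Fin m → Formula W → Set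
  i ⊨ φ = i Subset.∈ eval φ

  literal : Fin m → Formula W → Formula W
  literal i φ with i Subsetₚ.∈? eval φ
  ... | yes _ = φ
  ... | no  _ = neg φ

  literal-refl : ∀ i φ → i ⊨ literal i φ
  literal-refl i φ with i Subsetₚ.∈? eval φ
  ... | yes i∈ = i∈
  ... | no  i∉ = x∉p⇒x∈∁p i∉

  literal-agree : ∀ {i j} φ → j ⊨ literal i φ → lookup (eval φ) i ≡ lookup (eval φ) j
  literal-agree {i} {j} φ j∈ with i Subsetₚ.∈? eval φ
  ... | yes i∈ = trans ([]=⇒lookup i∈) (sym ([]=⇒lookup j∈))
  ... | no  i∉ = trans (¬-not (i∉ ∘ lookup⇒[]= i _))
                       (sym (¬-not (x∈∁p⇒x∉p j∈ ∘ lookup⇒[]= j _)))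

  -- Finite conjunctions and disjunctions.

  module _ (W≠∅ : Satisfiable W) where

    private
      φ₀ : Formula W
      φ₀ = operand _ (proj₂ W≠∅)

    -- Formulas have no constants, so the units of the two folds, the strings of all ones and of all
    -- zeros, are built from an operand; this is where `W` has to be nonempty.
    ⋀[_] ⋁[_] : List (Formula W) → Formula W
    ⋀[_] = List.foldr _⋀_ (φ₀ ⋁ neg φ₀)
    ⋁[_] = List.foldr _⋁_ (φ₀ ⋀ neg φ₀)

    ⊨-⋀⁺ : ∀ {j φs} → All (j ⊨_) φs → j ⊨ ⋀[ φs ]
    ⊨-⋀⁺ {j} [] with j Subsetₚ.∈? eval φ₀
    ... | yes j∈ = x∈p∪q⁺ (inj₁ j∈)
    ... | no  j∉ = x∈p∪q⁺ (inj₂ (x∉p⇒x∈∁p j∉))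
    ⊨-⋀⁺ (p ∷ ps) = x∈p∩q⁺ (p , ⊨-⋀⁺ ps)

    ⊨-⋀⁻ : ∀ {j} φs → j ⊨ ⋀[ φs ] → All (j ⊨_) φs
    ⊨-⋀⁻ []       _  = []
    ⊨-⋀⁻ (φ ∷ φs) j∈ with p , ps ← x∈p∩q⁻ (eval φ) _ j∈ = p ∷ ⊨-⋀⁻ φs ps

    ⊨-⋁⁺ : ∀ {j φs} → Any (j ⊨_) φs → j ⊨ ⋁[ φs ]
    ⊨-⋁⁺ (here p)   = x∈p∪q⁺ (inj₁ p)
    ⊨-⋁⁺ (there ps) = x∈p∪q⁺ (inj₂ (⊨-⋁⁺ ps))

    ⊨-⋁⁻ : ∀ {j} φs → j ⊨ ⋁[ φs ] → Any (j ⊨_) φs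
    ⊨-⋁⁻ [] j∈ with p , q ← x∈p∩q⁻ (eval φ₀) _ j∈ = contradiction p (x∈∁p⇒x∉p q)
    ⊨-⋁⁻ (φ ∷ φs) j∈ = [ here , there ∘ ⊨-⋁⁻ φs ]′ (x∈p∪q⁻ (eval φ) _ j∈)

    -- Invariant strings in disjunctive normal form.

    module _ (W-fin : Finite W) where

      operands : List (Formula W)
      operands =
        let _ , ws , _ , _ , ∈ws = W-fin in
        mapWith∈ ws (λ w∈ws → operand _ (Equivalence.to (∈ws _) w∈ws))

      -- Stated through `eval`, since the listed operand carries its own proof of membership in `W`,
      -- which may differ from the given one.
      operands-complete : ∀ {w} → w ∈ W → Any (λ φ → eval φ ≡ w) operands
      operands-complete {w} w∈W =
        let _ , ws , _ , _ , ∈ws = W-fin in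
        mapWith∈⁺ _ (w , Equivalence.from (∈ws w) w∈W , refl)

      indicator : Fin m → Formula W
      indicator i = ⋀[ List.map (literal i) operands ]

      indicator-refl : ∀ i → i ⊨ indicator i
      indicator-refl i = ⊨-⋀⁺ (Allₚ.map⁺ (All.universal (literal-refl i) operands))

      -- Some listed operand evaluates to the given string of `W`, and its literal is among the
      -- conjuncts satisfied at `j`; this forces the bits at `i` and `j` to agree.
      indicator-sound : ∀ {i j} → j ⊨ indicator i → Indistinguishable i j
      indicator-sound {i} {j} j∈ w∈W
        with p , eq ← All.lookupAny (Allₚ.map⁻ (⊨-⋀⁻ _ j∈)) (operands-complete w∈W) =
        subst (λ w → lookup w i ≡ lookup w j) eq
          (literal-agree (Any.lookup (operands-complete w∈W)) p)

      invariant⇒representable : Invariant Indistinguishable ⊆ Representable W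
      invariant⇒representable {s} inv = ⋁[ disjuncts ] , ⊆-antisym sound complete
        where
        -- One indicator is taken per position with bit 1, so a class may be repeated, harmlessly.
        -- If `s` is all zeros the list is empty and the unit of the disjunction evaluates to `s`.
        ones : List (Fin m)
        ones = filter (Subsetₚ._∈? s) (allFin m)

        disjuncts : List (Formula W)
        disjuncts = List.map indicator ones

        sound : ∀ {j} → j ⊨ ⋁[ disjuncts ] → j Subset.∈ s
        -- A satisfied disjunct places `j` in the class of some `i` where `s` has bit 1, and
        -- invariance carries that bit to `j`.
        sound {j} j∈
          with i , i∈ones , j∈χᵢ ← find (Anyₚ.map⁻ (⊨-⋁⁻ disjuncts j∈)) =
          lookup⇒[]= j s (trans (sym (inv (indicator-sound j∈χᵢ)))
            ([]=⇒lookup (proj₂ (∈-filter⁻ (Subsetₚ._∈? s) {xs = allFin m} i∈ones))))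

        complete : ∀ {j} → j Subset.∈ s → j ⊨ ⋁[ disjuncts ]
        complete {j} j∈s = ⊨-⋁⁺ (Anyₚ.map⁺
          (Any.map (λ { refl → indicator-refl j }) (∈-filter⁺ (Subsetₚ._∈? s) (∈-allFin j) j∈s)))

      Invariant≐Representable : Invariant (Derived (W ∪ Negations W)) ≐ Representable W
      Invariant≐Representable =
        (λ inv → invariant⇒representable (inv ∘ Indistinguishable⇒Derived)) ,
        (λ { (φ , refl) i∼j → eval-invariant φ (Derived⇒Indistinguishable i∼j) })

theorem7p2 : {ℓ : Level} (m : ℕ) (W : Pred (BitString m) ℓ) → Satisfiable W → Finite W →
    ∃[ u ] (Classes (Derived (W ∪ Negations W)) HasSize u) × (Representable W HasSize (2 ^ u))
theorem7p2 m W W≠∅ W-fin =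
  -- The witness for `u` is found by unification: it is the length of `classes`, which is also the
  -- codomain bound of `quotient`.
  _ , Classes-HasSize ∼-equiv _∼?_ ,
  HasSize-resp-≐ (Invariant≐Representable W W≠∅ W-fin)
    (Invariant-HasSize (quotient-isQuotient ∼-equiv _∼?_))
  where
  ∼-equiv = Derived-isEquivalence W
  _∼?_ = Derived-decidable W W-fin
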